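{- Let $p,q\in\mathbb{N}$ be coprime, $k\in\mathbb{N}$ squarefree, $m=-pk$, $n=qk$, and let $T$ be the torsion subgroup of $E(m,n)(\mathbb{Q})$, where $E(m,n)$ is the elliptic curve $y^2=x(x+m)(x+n)$. (i) If $T\cong\mathbb{Z}/2\times\mathbb{Z}/4$ or $T\cong\mathbb{Z}/2\times\mathbb{Z}/8$, then $k=1$. (ii) If $T\cong\mathbb{Z}/2\times\mathbb{Z}/6$, then $k=1$ or $k=3$.
   Context: $E(m,n)$ is the elliptic curve $y^2=x(x+m)(x+n)$ over $\mathbb{Q}$ with neutral element the point at infinity. -}

module Defs where

open import Algebra.Bundles using (RawGroup)
open import Algebra.Construct.DirectProduct using (rawGroup)
import Algebra.Definitions.RawMonoid as RawMonoidDefs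
open import Algebra.Morphism.Structures using (module GroupMorphisms)
open import Data.Integer.Base as ℤ using (ℤ; +_)
open import Data.Integer.Divisibility as ℤᵈ using ()
open import Data.Nat.Base as ℕ using (ℕ)
open import Data.Nat.Divisibility as ℕᵈ using ()
open import Data.Product.Base using (∃-syntax; _×_)
open import Data.Rational.Base using (ℚ; 0ℚ; 1ℚ; _+_; _*_; _-_; -_; _÷_; 1/_; _/_; NonZero; ≢-nonZero)
open import Data.Rational.Properties using (_≟_; *-assoc; *-identityʳ; *-identityˡ; *-inverseˡ; *-zeroʳ; +-0-group)
open import Data.Rational.Solver using (module +-*-Solver)
open import Algebra.Properties.Group +-0-group using (x∙y⁻¹≈ε⇒x≈y)
open import Function.Bundles using (_⇔_)
open import Level using (0ℓ)
open import Relation.Binary.PropositionalEquality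
open import Relation.Nullary using (yes; no)

open +-*-Solver using (solve; _:+_; _:*_; _:-_; :-_; con; _:=_)

Squarefree : ℕ → Set
Squarefree k = ∀ d → (d ℕ.* d) ℕᵈ.∣ k → d ≡ 1

-- The quotient ℤ/rℤ as a setoid: integers up to congruence modulo r.
infix 8 ℤ/_
ℤ/_ : ℕ → RawGroup 0ℓ 0ℓ
ℤ/ r = record
  { Carrier = ℤ
  ; _≈_     = λ a b → (+ r) ℤᵈ.∣ (a ℤ.- b)
  ; _∙_     = ℤ._+_
  ; ε       = + 0
  ; _⁻¹     = ℤ.-_
  }

infixr 6 _⊕_
_⊕_ : RawGroup 0ℓ 0ℓ → RawGroup 0ℓ 0ℓ → RawGroup 0ℓ 0ℓ
G ⊕ H = rawGroup G H

2ℚ 3ℚ : ℚ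
2ℚ = + 2 / 1
3ℚ = + 3 / 1

p÷q*q≡p : ∀ p q .{{_ : NonZero q}} → (p ÷ q) * q ≡ p
p÷q*q≡p p q = begin
  (p * 1/ q) * q  ≡⟨ *-assoc p (1/ q) q ⟩
  p * (1/ q * q)  ≡⟨ cong (p *_) (*-inverseˡ q) ⟩
  p * 1ℚ          ≡⟨ *-identityʳ p ⟩
  p               ∎
  where open ≡-Reasoning

*-cancelˡ-0 : ∀ p q → p ≢ 0ℚ → p * q ≡ 0ℚ → q ≡ 0ℚ
*-cancelˡ-0 p q p≢0 pq≡0 = begin
  q               ≡⟨ *-identityˡ q ⟨
  1ℚ * q          ≡⟨ cong (_* q) (*-inverseˡ p) ⟨
  (1/ p * p) * q  ≡⟨ *-assoc (1/ p) p q ⟩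
  1/ p * (p * q)  ≡⟨ cong (1/ p *_) pq≡0 ⟩
  1/ p * 0ℚ       ≡⟨ *-zeroʳ (1/ p) ⟩
  0ℚ              ∎
  where
  open ≡-Reasoning
  instance _ = ≢-nonZero p≢0

square≡0 : ∀ p → p * p ≡ 0ℚ → p ≡ 0ℚ
square≡0 p pp≡0 with p ≟ 0ℚ
... | yes p≡0 = p≡0
... | no  p≢0 = *-cancelˡ-0 p p p≢0 pp≡0

x≡y⇒x-y≡0 : ∀ {x y} → x ≡ y → x - y ≡ 0ℚ
x≡y⇒x-y≡0 {x} refl = solve 1 (λ x → x :- x := con 0ℚ) refl x

-- E(m,n) : y² = x(x+m)(x+n).  It is nonsingular exactly when 0, m, n are
-- pairwise distinct; the definitions below make sense regardless.
module Curve (m n : ℚ) where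

  cubic : ℚ → ℚ
  cubic x = x * (x + m) * (x + n)

  cubic′ : ℚ → ℚ
  cubic′ x = 3ℚ * (x * x) + 2ℚ * ((m + n) * x) + m * n

  -- The equation is an irrelevant field, so that points are equal as soon as
  -- their coordinates are.
  data Point : Set where
    𝒪      : Point
    affine : (x y : ℚ) → .(y * y ≡ cubic x) → Point

  -- The line of slope s through (x₁ , y₁) which meets the curve at abscissae
  -- x₁ and x₂ meets it a third time at abscissa thirdX; reflecting that point
  -- in the x-axis gives the ordinate sumY.
  thirdX : (s x₁ x₂ : ℚ) → ℚ
  thirdX s x₁ x₂ = s * s - (m + n) - x₁ - x₂

  sumY : (s x₁ y₁ x₂ : ℚ) → ℚ
  sumY s x₁ y₁ x₂ = - (y₁ + s * (thirdX s x₁ x₂ - x₁))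

  chord-closed : ∀ s x₁ y₁ x₂ y₂ → y₁ * y₁ ≡ cubic x₁ → y₂ * y₂ ≡ cubic x₂ →
                 x₂ - x₁ ≢ 0ℚ → s * (x₂ - x₁) ≡ y₂ - y₁ →
                 sumY s x₁ y₁ x₂ * sumY s x₁ y₁ x₂ ≡ cubic (thirdX s x₁ x₂)
  chord-closed s x₁ y₁ x₂ y₂ e₁ e₂ x₂-x₁≢0 slope = x∙y⁻¹≈ε⇒x≈y _ _
    (*-cancelˡ-0 (x₂ - x₁) _ x₂-x₁≢0 (begin
      (x₂ - x₁) * (Y * Y - cubic X)
        ≡⟨ solve 6 (λ s x₁ y₁ x₂ m n →
             let X = s :* s :- (m :+ n) :- x₁ :- x₂
                 Y = :- (y₁ :+ s :* (X :- x₁))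
                 f = λ x → x :* (x :+ m) :* (x :+ n)
                 L = y₁ :+ s :* (x₂ :- x₁)
             in (x₂ :- x₁) :* (Y :* Y :- f X)
                := (X :- x₁) :* (L :* L :- f x₂) :- (X :- x₂) :* (y₁ :* y₁ :- f x₁))
             refl s x₁ y₁ x₂ m n ⟩
      (X - x₁) * (L * L - cubic x₂) - (X - x₂) * (y₁ * y₁ - cubic x₁)
        ≡⟨ cong₂ (λ u v → (X - x₁) * u - (X - x₂) * v)
             (x≡y⇒x-y≡0 (trans (cong₂ _*_ L≡y₂ L≡y₂) e₂)) (x≡y⇒x-y≡0 e₁) ⟩
      (X - x₁) * 0ℚ - (X - x₂) * 0ℚ
        ≡⟨ solve 2 (λ a b → a :* con 0ℚ :- b :* con 0ℚ := con 0ℚ) refl (X - x₁) (X - x₂) ⟩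
      0ℚ ∎))
    where
    open ≡-Reasoning
    X = thirdX s x₁ x₂
    Y = sumY s x₁ y₁ x₂
    L = y₁ + s * (x₂ - x₁)
    L≡y₂ : L ≡ y₂
    L≡y₂ = trans (cong (λ t → y₁ + t) slope)
      (solve 2 (λ a b → a :+ (b :- a) := b) refl y₁ y₂)

  tangent-closed : ∀ s x y → y * y ≡ cubic x → s * (2ℚ * y) ≡ cubic′ x →
                   sumY s x y x * sumY s x y x ≡ cubic (thirdX s x x)
  tangent-closed s x y e slope = x∙y⁻¹≈ε⇒x≈y _ _ (begin
    Y * Y - cubic X
      ≡⟨ solve 5 (λ s x y m n →
           let X  = s :* s :- (m :+ n) :- x :- x
               Y  = :- (y :+ s :* (X :- x))
               f  = λ x → x :* (x :+ m) :* (x :+ n)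
               f′ = con 3ℚ :* (x :* x) :+ con 2ℚ :* ((m :+ n) :* x) :+ m :* n
           in Y :* Y :- f X
              := (y :* y :- f x) :+ (X :- x) :* (s :* (con 2ℚ :* y) :- f′))
           refl s x y m n ⟩
    (y * y - cubic x) + (X - x) * (s * (2ℚ * y) - cubic′ x)
      ≡⟨ cong₂ (λ u v → u + (X - x) * v) (x≡y⇒x-y≡0 e) (x≡y⇒x-y≡0 slope) ⟩
    0ℚ + (X - x) * 0ℚ
      ≡⟨ solve 1 (λ a → con 0ℚ :+ a :* con 0ℚ := con 0ℚ) refl (X - x) ⟩
    0ℚ ∎)
    where
    open ≡-Reasoning
    X = thirdX s x x
    Y = sumY s x y x

  chord-nonZero : ∀ {x₁ x₂} → x₁ ≢ x₂ → x₂ - x₁ ≢ 0ℚ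
  chord-nonZero x₁≢x₂ eq = x₁≢x₂ (sym (x∙y⁻¹≈ε⇒x≈y _ _ eq))

  tangent-nonZero : ∀ {x₁ y₁ x₂ y₂} → y₁ * y₁ ≡ cubic x₁ → y₂ * y₂ ≡ cubic x₂ →
                    x₁ ≡ x₂ → y₁ ≢ - y₂ → 2ℚ * y₁ ≢ 0ℚ
  tangent-nonZero {y₁ = y₁} {y₂ = y₂} e₁ e₂ refl y₁≢-y₂ 2y₁≡0 =
    y₁≢-y₂ (trans y₁≡0 (cong -_ (sym y₂≡0)))
    where
    y₁≡0 : y₁ ≡ 0ℚ
    y₁≡0 = *-cancelˡ-0 2ℚ y₁ (λ ()) 2y₁≡0
    y₂≡0 : y₂ ≡ 0ℚ
    y₂≡0 = square≡0 y₂ (trans e₂ (trans (sym e₁) (cong₂ _*_ y₁≡0 y₁≡0)))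

  chordSlope : (x₁ y₁ x₂ y₂ : ℚ) → .(x₁ ≢ x₂) → ℚ
  chordSlope x₁ y₁ x₂ y₂ x₁≢x₂ =
    ((y₂ - y₁) ÷ (x₂ - x₁)) {{≢-nonZero (chord-nonZero x₁≢x₂)}}

  tangentSlope : (x y : ℚ) → .(2ℚ * y ≢ 0ℚ) → ℚ
  tangentSlope x y 2y≢0 = (cubic′ x ÷ (2ℚ * y)) {{≢-nonZero 2y≢0}}

  infixl 6 _⊞_
  _⊞_ : Point → Point → Point
  𝒪 ⊞ Q = Q
  P@(affine _ _ _) ⊞ 𝒪 = P
  affine x₁ y₁ e₁ ⊞ affine x₂ y₂ e₂ with x₁ ≟ x₂
  ... | no x₁≢x₂ =
    let s = chordSlope x₁ y₁ x₂ y₂ x₁≢x₂ in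
    affine (thirdX s x₁ x₂) (sumY s x₁ y₁ x₂)
      (chord-closed s x₁ y₁ x₂ y₂ e₁ e₂ (chord-nonZero x₁≢x₂)
        (p÷q*q≡p (y₂ - y₁) (x₂ - x₁) {{≢-nonZero (chord-nonZero x₁≢x₂)}}))
  ... | yes x₁≡x₂ with y₁ ≟ - y₂
  ...   | yes _ = 𝒪
  ...   | no y₁≢-y₂ =
    let s = tangentSlope x₁ y₁ (tangent-nonZero e₁ e₂ x₁≡x₂ y₁≢-y₂) in
    affine (thirdX s x₁ x₁) (sumY s x₁ y₁ x₁)
      (tangent-closed s x₁ y₁ e₁
        (p÷q*q≡p (cubic′ x₁) (2ℚ * y₁)
          {{≢-nonZero (tangent-nonZero e₁ e₂ x₁≡x₂ y₁≢-y₂)}}))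

  ⊟_ : Point → Point
  ⊟ 𝒪            = 𝒪
  ⊟ affine x y e = affine x (- y)
    (trans (solve 1 (λ y → (:- y) :* (:- y) := y :* y) refl y) e)

  pointGroup : RawGroup 0ℓ 0ℓ
  pointGroup = record
    { Carrier = Point
    ; _≈_     = _≡_
    ; _∙_     = _⊞_
    ; ε       = 𝒪
    ; _⁻¹     = ⊟_
    }

  open RawMonoidDefs (RawGroup.rawMonoid pointGroup) public
    using () renaming (_×_ to _·_)

  IsTorsion : Point → Set
  IsTorsion P = ∃[ r ] (1 ℕ.≤ r × r · P ≡ 𝒪)

  -- An isomorphism from G onto the torsion subgroup, given as an injective
  -- homomorphism into the whole group of points whose image is exactly the set
  -- of torsion points.  (In this form no proof that torsion points are closed
  -- under addition is needed.)
  record TorsionSubgroup≅ (G : RawGroup 0ℓ 0ℓ) : Set where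
    open RawGroup G using (Carrier)
    open GroupMorphisms G pointGroup using (IsGroupMonomorphism)
    field
      to             : Carrier → Point
      isMonomorphism : IsGroupMonomorphism to
      image          : ∀ P → IsTorsion P ⇔ (∃[ g ] to g ≡ P)

infix 4 torsion[E⟨_,_⟩]≅_
torsion[E⟨_,_⟩]≅_ : (m n : ℤ) → RawGroup 0ℓ 0ℓ → Set
torsion[E⟨ m , n ⟩]≅ G = Curve.TorsionSubgroup≅ (m / 1) (n / 1) G

{-# OPTIONS --safe #-}

-- On a curve y² = (x - e₁)(x - e₂)(x - e₃), the abscissa X of a double 2P makes
-- every X - eᵢ a square.  Here the roots are 0, pk and -qk.
--
-- If P has order 4 then X is a root, and by signs it is the largest one, pk.  So
-- pk and (p + q)k are squares, and k, being squarefree, divides both p and p + q.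
--
-- If P has order 3 then P and 2P have the same abscissa x, so x = (A/D)² in lowest
-- terms with A² - pkD² and A² + qkD² squares.  A common divisor d of A and k then
-- satisfies d² ∣ pkD² and d² ∣ qkD², hence d² ∣ k and d = 1.  Reducing the equation
-- 4x²(x + m)(x + n) = (x² - mn)² of x modulo k gives k ∣ 3A⁸, so k ∣ 3.
module Submission where

open import Algebra.Bundles using (RawGroup)
open import Algebra.Morphism.Structures using (module GroupMorphisms)
open import Data.Integer.Base as ℤ using (ℤ; +_; -[1+_]; -_; ∣_∣)
import Data.Integer.Divisibility.Signed as ℤˢ
import Data.Integer.Properties as ℤₚ
import Data.Integer.Solver as ℤSolver
open import Data.Nat.Base as ℕ using (ℕ; zero; suc; _*_; NonZero)
open import Data.Nat.Coprimality as Coprimality using (Coprime)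
open import Data.Nat.Divisibility as ℕᵈ using (_∣_; divides; divides-refl)
import Data.Nat.DivMod as ℕ
open import Data.Nat.GCD using (gcd; gcd[m,n]∣m; gcd[m,n]∣n; gcd[m,n]≢0)
import Data.Nat.Properties as ℕₚ
import Data.Nat.Solver as ℕSolver
open import Data.Product.Base using (_×_; _,_; proj₁; proj₂; ∃-syntax)
open import Data.Rational.Base as ℚ using (ℚ; mkℚ; 0ℚ; ↥_; ↧_; ↧ₙ_; toℚᵘ)
import Data.Rational.Properties as ℚₚ
import Data.Rational.Solver as ℚSolver
open import Data.Rational.Unnormalised.Base as ℚᵘ using (mkℚᵘ; *≡*)
import Data.Rational.Unnormalised.Properties as ℚᵘₚ
open import Data.Sum.Base using (_⊎_; inj₁; inj₂)
open import Level using (0ℓ)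
open import Relation.Binary.PropositionalEquality using (_≡_; _≢_; refl; sym; trans; cong; cong₂; subst; subst₂; module ≡-Reasoning)
open import Relation.Nullary using (¬_; yes; no; recompute; contradiction)
open import Relation.Nullary.Decidable using (from-no)
open import Defs

open import Algebra.Properties.Group ℚₚ.+-0-group using (x∙y⁻¹≈ε⇒x≈y)

-- Divisibility by squarefree numbers

coprime-* : ∀ {a b c} → Coprime a c → Coprime b c → Coprime (a * b) c
coprime-* a⊥c b⊥c {i} (i∣ab , i∣c) = b⊥c (Coprimality.coprime-divisor i⊥a i∣ab , i∣c)
  where
  i⊥a : Coprime i _
  i⊥a (j∣i , j∣a) = a⊥c (j∣a , ℕᵈ.∣-trans j∣i i∣c)

squarefree⇒≢0 : ∀ {k} → Squarefree k → k ≢ 0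
squarefree⇒≢0 sf refl with () ← sf 2 (4 ℕᵈ.∣0)

squarefree-∣ : ∀ {d k} → Squarefree k → d ∣ k → Squarefree d
squarefree-∣ sf d∣k e ee∣d = sf e (ℕᵈ.∣-trans ee∣d d∣k)

-- Divide both numbers by `g`. Then `k′` divides `a′ * (a′ * g)` and is coprime to `a′`, so
-- `k′ ∣ g`. Thus `k′ * k′` divides `k`, which forces `k′ ≡ 1` and `k ≡ g`.
squarefree-∣-square : ∀ {k} a → Squarefree k → k ∣ a * a → k ∣ a
squarefree-∣-square {k} a sf k∣aa = subst (_∣ a) g≡k (gcd[m,n]∣n k a)
  where
  open ≡-Reasoning
  g = gcd k a
  instance
    g≢0 : NonZero g
    g≢0 = ℕ.≢-nonZero (gcd[m,n]≢0 k a (inj₁ (squarefree⇒≢0 sf)))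
  k′ = k ℕ./ g
  a′ = a ℕ./ g
  k′g≡k : k′ * g ≡ k
  k′g≡k = ℕ.m/n*n≡m (gcd[m,n]∣m k a)
  aa≡ : a * a ≡ (a′ * (a′ * g)) * g
  aa≡ = begin
    a * a                  ≡⟨ cong₂ _*_ (ℕ.m/n*n≡m (gcd[m,n]∣n k a)) (ℕ.m/n*n≡m (gcd[m,n]∣n k a)) ⟨
    (a′ * g) * (a′ * g)    ≡⟨ solve 2 (λ a g → (a :* g) :* (a :* g) := (a :* (a :* g)) :* g) refl a′ g ⟩
    (a′ * (a′ * g)) * g    ∎
    where open ℕSolver.+-*-Solver
  k′∣g : k′ ∣ g
  k′∣g = Coprimality.coprime-divisor k′⊥a′ (Coprimality.coprime-divisor k′⊥a′
    (ℕᵈ.*-cancelʳ-∣ g (subst₂ _∣_ (sym k′g≡k) aa≡ k∣aa)))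
    where
    k′⊥a′ : Coprime k′ a′
    k′⊥a′ = Coprimality.coprime-/gcd k a
  g≡k : g ≡ k
  g≡k = begin
    g         ≡⟨ ℕₚ.*-identityˡ g ⟨
    1 * g     ≡⟨ cong (_* g) (sf k′ (subst (k′ * k′ ∣_) k′g≡k (ℕᵈ.*-monoʳ-∣ k′ k′∣g))) ⟨
    k′ * g    ≡⟨ k′g≡k ⟩
    k         ∎

squarefree-∣-cofactor : ∀ {k} N a → Squarefree k → a * a ≡ N * k → k ∣ N
squarefree-∣-cofactor {k} N a sf aa≡Nk =
  ℕᵈ.*-cancelʳ-∣ k {{ℕ.≢-nonZero (squarefree⇒≢0 sf)}}
    (subst (k * k ∣_) aa≡Nk (ℕᵈ.*-pres-∣ k∣a k∣a))
  where
  k∣a : k ∣ a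
  k∣a = squarefree-∣-square a sf (divides N aa≡Nk)

-- Since `d` divides B², squarefreeness gives `d ∣ ∣ B ∣`. So `d * d` divides both squares, hence
-- their difference M.
squarefree-∣-difference : ∀ {d} A B M → Squarefree d → d ∣ ∣ A ∣ → d ∣ ∣ M ∣ →
                          B ℤ.* B ≡ A ℤ.* A ℤ.+ M → d * d ∣ ∣ M ∣
squarefree-∣-difference {d} A B M sf d∣A d∣M BB≡AA+M =
  subst (_∣ ∣ M ∣) (ℤₚ.abs-* (+ d) (+ d))
    (ℤˢ.∣⇒∣ᵤ {i = M} (ℤˢ.∣m+n∣m⇒∣n {m = A ℤ.* A} (subst (_ ℤˢ.∣_) BB≡AA+M (dd∣ B d∣B)) (dd∣ A d∣A)))
  where
  signed : ∀ Z → d ∣ ∣ Z ∣ → (+ d) ℤˢ.∣ Z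
  signed Z = ℤˢ.∣ᵤ⇒∣
  d∣B : d ∣ ∣ B ∣
  d∣B = squarefree-∣-square ∣ B ∣ sf (subst (d ∣_) (ℤₚ.abs-* B B)
    (ℤˢ.∣⇒∣ᵤ {i = B ℤ.* B} (subst (+ d ℤˢ.∣_) (sym BB≡AA+M)
      (ℤˢ.∣m∣n⇒∣m+n (ℤˢ.∣m⇒∣m*n A (signed A d∣A)) (signed M d∣M)))))
  dd∣ : ∀ Z → d ∣ ∣ Z ∣ → (+ d ℤ.* + d) ℤˢ.∣ (Z ℤ.* Z)
  dd∣ Z d∣Z = ℤˢ.∣-trans (ℤˢ.*-monoʳ-∣ (+ d) {+ d} {Z} (signed Z d∣Z)) (ℤˢ.*-monoˡ-∣ Z {+ d} {Z} (signed Z d∣Z))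

∣3⇒≡1⊎≡3 : ∀ {k} → k ∣ 3 → k ≡ 1 ⊎ k ≡ 3
∣3⇒≡1⊎≡3 {0} 0∣3 with () ← ℕᵈ.0∣⇒≡0 0∣3
∣3⇒≡1⊎≡3 {1} _ = inj₁ refl
∣3⇒≡1⊎≡3 {2} 2∣3 = contradiction 2∣3 (from-no (2 ℕᵈ.∣? 3))
∣3⇒≡1⊎≡3 {3} _ = inj₂ refl
∣3⇒≡1⊎≡3 {suc (suc (suc (suc k)))} k∣3 = contradiction k∣3 (ℕᵈ.>⇒∤ (ℕ.s≤s (ℕ.s≤s (ℕ.s≤s (ℕ.s≤s ℕ.z≤n)))))

-- The embedding of ℤ in ℚ

ι : ℤ → ℚ
ι z = z ℚ./ 1

-- Arithmetic in `ℚ` reduces fractions by a gcd, which is stuck on variables. In `ℚᵘ` fractions over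
-- 1 multiply by computation, so the transfer lemmas go through `toℚᵘ`.
toℚᵘ-ι : ∀ z → toℚᵘ (ι z) ℚᵘ.≃ mkℚᵘ z 0
toℚᵘ-ι z = ℚₚ.toℚᵘ-fromℚᵘ (mkℚᵘ z 0)

ι-injective : ∀ {a b} → ι a ≡ ι b → a ≡ b
ι-injective {a} {b} eq with *≡* e ← ℚₚ.fromℚᵘ-injective {mkℚᵘ a 0} {mkℚᵘ b 0} eq =
  trans (sym (ℤₚ.*-identityʳ a)) (trans e (ℤₚ.*-identityʳ b))

-- x ≐ a is x ≡ ι a wrapped in a record, so that a can be inferred (ι itself unfolds);
-- the operations below transfer a polynomial expression by a term of the same shape.
infix 4 _≐_
record _≐_ (x : ℚ) (a : ℤ) : Set where
  constructor ≐-intro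
  field ≐-elim : x ≡ ι a
open _≐_

≐-ι : ∀ a → ι a ≐ a
≐-ι a = ≐-intro refl

≐-trans : ∀ {x y a} → x ≡ y → y ≐ a → x ≐ a
≐-trans refl h = h

≐-unique : ∀ {x a b} → x ≐ a → x ≐ b → a ≡ b
≐-unique (≐-intro h) (≐-intro h′) = ι-injective (trans (sym h) h′)

≐-* : ∀ {x y a b} → x ≐ a → y ≐ b → x ℚ.* y ≐ a ℤ.* b
≐-* {_} {_} {a} {b} (≐-intro refl) (≐-intro refl) = ≐-intro (ℚₚ.toℚᵘ-injective (begin
  toℚᵘ (ι a ℚ.* ι b)           ≈⟨ ℚₚ.toℚᵘ-homo-* (ι a) (ι b) ⟩
  toℚᵘ (ι a) ℚᵘ.* toℚᵘ (ι b)   ≈⟨ ℚᵘₚ.*-cong (toℚᵘ-ι a) (toℚᵘ-ι b) ⟩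
  mkℚᵘ (a ℤ.* b) 0             ≈⟨ toℚᵘ-ι (a ℤ.* b) ⟨
  toℚᵘ (ι (a ℤ.* b))           ∎))
  where open import Relation.Binary.Reasoning.Setoid ℚᵘₚ.≃-setoid

≐-+ : ∀ {x y a b} → x ≐ a → y ≐ b → x ℚ.+ y ≐ a ℤ.+ b
≐-+ {_} {_} {a} {b} (≐-intro refl) (≐-intro refl) = ≐-intro (ℚₚ.toℚᵘ-injective (begin
  toℚᵘ (ι a ℚ.+ ι b)                    ≈⟨ ℚₚ.toℚᵘ-homo-+ (ι a) (ι b) ⟩
  toℚᵘ (ι a) ℚᵘ.+ toℚᵘ (ι b)            ≈⟨ ℚᵘₚ.+-cong (toℚᵘ-ι a) (toℚᵘ-ι b) ⟩
  mkℚᵘ (a ℤ.* + 1 ℤ.+ b ℤ.* + 1) 0      ≡⟨ cong₂ (λ u v → mkℚᵘ (u ℤ.+ v) 0) (ℤₚ.*-identityʳ a) (ℤₚ.*-identityʳ b) ⟩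
  mkℚᵘ (a ℤ.+ b) 0                      ≈⟨ toℚᵘ-ι (a ℤ.+ b) ⟨
  toℚᵘ (ι (a ℤ.+ b))                    ∎))
  where open import Relation.Binary.Reasoning.Setoid ℚᵘₚ.≃-setoid

≐-neg : ∀ {x a} → x ≐ a → ℚ.- x ≐ - a
≐-neg {_} {a} (≐-intro refl) = ≐-intro (ℚₚ.toℚᵘ-injective (begin
  toℚᵘ (ℚ.- ι a)     ≈⟨ ℚₚ.toℚᵘ-homo‿- (ι a) ⟩
  ℚᵘ.- toℚᵘ (ι a)    ≈⟨ ℚᵘₚ.-‿cong (toℚᵘ-ι a) ⟩
  mkℚᵘ (- a) 0       ≈⟨ toℚᵘ-ι (- a) ⟨
  toℚᵘ (ι (- a))     ∎))
  where open import Relation.Binary.Reasoning.Setoid ℚᵘₚ.≃-setoid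

≐-- : ∀ {x y a b} → x ≐ a → y ≐ b → x ℚ.- y ≐ a ℤ.- b
≐-- hx hy = ≐-+ hx (≐-neg hy)

-- Rational square roots of integers

w*↧w≐↥w : ∀ w → w ℚ.* ι (↧ w) ≐ ↥ w
w*↧w≐↥w w@(mkℚ n d-1 _) = ≐-intro (ℚₚ.toℚᵘ-injective (begin
  toℚᵘ (w ℚ.* ι (↧ w))               ≈⟨ ℚₚ.toℚᵘ-homo-* w (ι (↧ w)) ⟩
  toℚᵘ w ℚᵘ.* toℚᵘ (ι (↧ w))         ≈⟨ ℚᵘₚ.*-cong (ℚᵘₚ.≃-refl {toℚᵘ w}) (toℚᵘ-ι (↧ w)) ⟩
  mkℚᵘ n d-1 ℚᵘ.* mkℚᵘ (↧ w) 0       ≈⟨ *≡* (trans (ℤₚ.*-identityʳ _) (cong (λ t → n ℤ.* (+ suc t)) (sym (ℕₚ.*-identityʳ d-1)))) ⟩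
  mkℚᵘ n 0                           ≈⟨ toℚᵘ-ι n ⟨
  toℚᵘ (ι n)                         ∎))
  where open import Relation.Binary.Reasoning.Setoid ℚᵘₚ.≃-setoid

numerator⊥denominator : ∀ w → Coprime ∣ ↥ w ∣ (↧ₙ w)
numerator⊥denominator (mkℚ _ _ c) = Coprimality.recompute c

-- With w = n/d in lowest terms, n² = Zd² gives d ∣ n². As d is coprime to n, it divides n and
-- equals 1.
square-integral⇒integral : ∀ w {Z} → w ℚ.* w ≐ Z → ∃[ E ] w ≐ E
square-integral⇒integral w@(mkℚ n d-1 _) {Z} ww≐Z = n , w≐n
  where
  nn≡Zdd : n ℤ.* n ≡ Z ℤ.* (↧ w ℤ.* ↧ w)
  nn≡Zdd = ≐-unique (≐-* (w*↧w≐↥w w) (w*↧w≐↥w w)) (≐-trans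
    (solve 2 (λ w d → (w :* d) :* (w :* d) := (w :* w) :* (d :* d)) refl w (ι (↧ w)))
    (≐-* ww≐Z (≐-* (≐-ι (↧ w)) (≐-ι (↧ w)))))
    where open ℚSolver.+-*-Solver
  d∣nn : ↧ₙ w ∣ ∣ n ∣ * ∣ n ∣
  d∣nn = subst (↧ₙ w ∣_) (ℤₚ.abs-* n n) (ℤˢ.∣⇒∣ᵤ {↧ w}
    (subst (↧ w ℤˢ.∣_) (sym nn≡Zdd) (ℤˢ.∣n⇒∣m*n Z (ℤˢ.∣m⇒∣m*n (↧ w) ℤˢ.∣-refl))))
  d⊥n : Coprime (↧ₙ w) ∣ n ∣
  d⊥n = Coprimality.sym (numerator⊥denominator w)
  d≡1 : ↧ₙ w ≡ 1
  d≡1 = d⊥n (ℕᵈ.∣-refl , Coprimality.coprime-divisor d⊥n d∣nn)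
  w≐n : w ≐ n
  w≐n = ≐-trans (trans (sym (ℚₚ.*-identityʳ w)) (cong (λ d → w ℚ.* ι (+ d)) (sym d≡1))) (w*↧w≐↥w w)

square-≐⇒square : ∀ w {Z} → w ℚ.* w ≐ Z → ∃[ E ] E ℤ.* E ≡ Z
square-≐⇒square w ww≐Z with square-integral⇒integral w ww≐Z
... | E , w≐E = E , ≐-unique (≐-* w≐E w≐E) ww≐Z

squarefree-∣-ℚ-cofactor : ∀ {k} N w → Squarefree k → w ℚ.* w ≐ + (N * k) → k ∣ N
squarefree-∣-ℚ-cofactor N w sf ww≐Nk with square-≐⇒square w ww≐Nk
... | E , EE≡Nk = squarefree-∣-cofactor N ∣ E ∣ sf (trans (sym (ℤₚ.abs-* E E)) (cong ∣_∣ EE≡Nk))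

square≢neg : ∀ w N .{{_ : NonZero N}} → ¬ w ℚ.* w ≐ - (+ N)
square≢neg w (suc N) ww≐-N with square-≐⇒square w ww≐-N
-- In each sign case the product computes to a nonnegative integer, which cannot unify with a
-- negative one.
... | + zero   , ()
... | + suc _  , ()
... | -[1+ _ ] , ()

quotient-square : ∀ d u X → d ≢ 0ℚ → (d ℚ.* d) ℚ.* X ≡ u ℚ.* u → ∃[ w ] w ℚ.* w ≡ X
quotient-square d u X d≢0 ddX≡uu = w , x∙y⁻¹≈ε⇒x≈y _ _
  -- Multiplying w² - X by d twice clears the denominator of w = u/d.
  (*-cancelˡ-0 d _ d≢0 (*-cancelˡ-0 d _ d≢0 (begin
    d ℚ.* (d ℚ.* (w ℚ.* w ℚ.- X))
      ≡⟨ solve 3 (λ d w X → d :* (d :* (w :* w :- X)) := (w :* d) :* (w :* d) :- (d :* d) :* X) refl d w X ⟩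
    (w ℚ.* d) ℚ.* (w ℚ.* d) ℚ.- (d ℚ.* d) ℚ.* X
      ≡⟨ x≡y⇒x-y≡0 (trans (cong₂ ℚ._*_ wd≡u wd≡u) (sym ddX≡uu)) ⟩
    0ℚ ∎)))
  where
  open ≡-Reasoning
  open ℚSolver.+-*-Solver
  instance _ = ℚ.≢-nonZero d≢0
  w = u ℚ.÷ d
  wd≡u : w ℚ.* d ≡ u
  wd≡u = p÷q*q≡p u d

x≡-x⇒x≡0 : ∀ x → x ≡ ℚ.- x → x ≡ 0ℚ
x≡-x⇒x≡0 x x≡-x = *-cancelˡ-0 2ℚ x (λ ()) (trans
  (solve 1 (λ x → con 2ℚ :* x := x :- (:- x)) refl x) (x≡y⇒x-y≡0 x≡-x))
  where open ℚSolver.+-*-Solver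

x*y≡0⇒x≡0⊎y≡0 : ∀ x y → x ℚ.* y ≡ 0ℚ → x ≡ 0ℚ ⊎ y ≡ 0ℚ
x*y≡0⇒x≡0⊎y≡0 x y xy≡0 with x ℚₚ.≟ 0ℚ
... | yes x≡0 = inj₁ x≡0
... | no  x≢0 = inj₂ (*-cancelˡ-0 x y x≢0 xy≡0)

-- Points of order 4 and 3

4ℚ : ℚ
4ℚ = + 4 ℚ./ 1

module _ (m n : ℚ) where
  open Curve m n
  open ℚSolver.+-*-Solver

  -- What the proof needs to know about X = x(2P) for a point P of abscissa x.
  record IsDouble (x X : ℚ) : Set where
    field
      X-square   : ∃[ w ] w ℚ.* w ≡ X
      X+m-square : ∃[ w ] w ℚ.* w ≡ X ℚ.+ m
      X+n-square : ∃[ w ] w ℚ.* w ≡ X ℚ.+ n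
      duplication : 4ℚ ℚ.* cubic x ℚ.* X ≡ (x ℚ.* x ℚ.- m ℚ.* n) ℚ.* (x ℚ.* x ℚ.- m ℚ.* n)

  -- The root of (2y)² X is the numerator of the duplication formula; those of
  -- (2y)² (X + m) and (2y)² (X + n) are its translates to the other two roots of the cubic.
  tangent-isDouble : ∀ x y s → y ℚ.* y ≡ cubic x → 2ℚ ℚ.* y ≢ 0ℚ → s ℚ.* (2ℚ ℚ.* y) ≡ cubic′ x →
                     IsDouble x (thirdX s x x)
  tangent-isDouble x y s yy≡f 2y≢0 slope = record
    { X-square = quotient-square (2ℚ ℚ.* y) (x ℚ.* x ℚ.- m ℚ.* n) X 2y≢0 X-eq
    ; X+m-square = quotient-square (2ℚ ℚ.* y) ((x ℚ.+ m) ℚ.* (x ℚ.+ m) ℚ.- m ℚ.* (m ℚ.- n)) (X ℚ.+ m) 2y≢0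
        (trans (shift m) (solve 3 (λ x m n →
          let f  = x :* (x :+ m) :* (x :+ n)
              f′ = con 3ℚ :* (x :* x) :+ con 2ℚ :* ((m :+ n) :* x) :+ m :* n
              u  = (x :+ m) :* (x :+ m) :- m :* (m :- n)
          in f′ :* f′ :- con 4ℚ :* f :* (m :+ n :+ x :+ x :- m) := u :* u) refl x m n))
    ; X+n-square = quotient-square (2ℚ ℚ.* y) ((x ℚ.+ n) ℚ.* (x ℚ.+ n) ℚ.- n ℚ.* (n ℚ.- m)) (X ℚ.+ n) 2y≢0
        (trans (shift n) (solve 3 (λ x m n →
          let f  = x :* (x :+ m) :* (x :+ n)
              f′ = con 3ℚ :* (x :* x) :+ con 2ℚ :* ((m :+ n) :* x) :+ m :* n
              u  = (x :+ n) :* (x :+ n) :- n :* (n :- m)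
          in f′ :* f′ :- con 4ℚ :* f :* (m :+ n :+ x :+ x :- n) := u :* u) refl x m n))
    ; duplication = begin
        4ℚ ℚ.* cubic x ℚ.* X
          ≡⟨ cong (λ t → 4ℚ ℚ.* t ℚ.* X) yy≡f ⟨
        4ℚ ℚ.* (y ℚ.* y) ℚ.* X
          ≡⟨ solve 2 (λ y X → con 4ℚ :* (y :* y) :* X := (con 2ℚ :* y) :* (con 2ℚ :* y) :* X) refl y X ⟩
        (2ℚ ℚ.* y) ℚ.* (2ℚ ℚ.* y) ℚ.* X
          ≡⟨ X-eq ⟩
        (x ℚ.* x ℚ.- m ℚ.* n) ℚ.* (x ℚ.* x ℚ.- m ℚ.* n) ∎
    }
    where
    open ≡-Reasoning
    X = thirdX s x x
    -- Substituting the slope equation and y² = f(x) eliminates s and y. The resulting polynomial in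
    -- x, m, n is a perfect square for c = 0, m and n.
    shift : ∀ c → (2ℚ ℚ.* y) ℚ.* (2ℚ ℚ.* y) ℚ.* (X ℚ.+ c) ≡
                  cubic′ x ℚ.* cubic′ x ℚ.- 4ℚ ℚ.* cubic x ℚ.* (m ℚ.+ n ℚ.+ x ℚ.+ x ℚ.- c)
    shift c = trans
      (solve 6 (λ s x y m n c →
        (con 2ℚ :* y) :* (con 2ℚ :* y) :* (s :* s :- (m :+ n) :- x :- x :+ c)
        := (s :* (con 2ℚ :* y)) :* (s :* (con 2ℚ :* y))
           :- con 4ℚ :* (y :* y) :* (m :+ n :+ x :+ x :- c)) refl s x y m n c)
      (cong₂ (λ u v → u ℚ.* u ℚ.- 4ℚ ℚ.* v ℚ.* (m ℚ.+ n ℚ.+ x ℚ.+ x ℚ.- c)) slope yy≡f)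
    X-eq : (2ℚ ℚ.* y) ℚ.* (2ℚ ℚ.* y) ℚ.* X ≡ (x ℚ.* x ℚ.- m ℚ.* n) ℚ.* (x ℚ.* x ℚ.- m ℚ.* n)
    X-eq = trans (cong ((2ℚ ℚ.* y) ℚ.* (2ℚ ℚ.* y) ℚ.*_) (sym (ℚₚ.+-identityʳ X)))
      (trans (shift 0ℚ) (solve 3 (λ x m n →
          let f  = x :* (x :+ m) :* (x :+ n)
              f′ = con 3ℚ :* (x :* x) :+ con 2ℚ :* ((m :+ n) :* x) :+ m :* n
              u  = x :* x :- m :* n
          in f′ :* f′ :- con 4ℚ :* f :* (m :+ n :+ x :+ x :- con 0ℚ) := u :* u) refl x m n))

  -- The value at `𝒪` is a mere default: the projections are applied to equations between affine
  -- points.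
  abscissa ordinate : Point → ℚ
  abscissa 𝒪              = 0ℚ
  abscissa (affine x _ _) = x
  ordinate 𝒪              = 0ℚ
  ordinate (affine _ y _) = y

  -- The case split retraces that of `⊞`. The case y = -y needs no clause, since there the sum is
  -- `𝒪` and `eq` is absurd.
  double-isDouble : ∀ x y X Y .(e : y ℚ.* y ≡ cubic x) .(e′ : Y ℚ.* Y ≡ cubic X) →
                    affine x y e ⊞ affine x y e ≡ affine X Y e′ → IsDouble x X
  double-isDouble x y X Y e e′ eq with x ℚₚ.≟ x
  ... | no x≢x = contradiction refl x≢x
  ... | yes x≡x with y ℚₚ.≟ ℚ.- y
  ...   | no y≢-y = subst (IsDouble x) (cong abscissa eq)
    (tangent-isDouble x y (tangentSlope x y 2y≢0) yy≡f 2y≢0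
      (p÷q*q≡p (cubic′ x) (2ℚ ℚ.* y) {{ℚ.≢-nonZero 2y≢0}}))
    where
    -- The irrelevant curve equation is recovered by deciding equality in `ℚ`.
    yy≡f : y ℚ.* y ≡ cubic x
    yy≡f = recompute (_ ℚₚ.≟ _) e
    2y≢0 : 2ℚ ℚ.* y ≢ 0ℚ
    2y≢0 = tangent-nonZero {x} {y} {x} {y} yy≡f yy≡f refl y≢-y

  -- The double 2P = (X, Y) equals its own negative, so Y = 0 and X is a root of the cubic.
  order4 : ∀ P → P ⊞ P ≢ 𝒪 → P ⊞ P ≡ ⊟ (P ⊞ P) → ∃[ x ] ∃[ X ] IsDouble x X × cubic X ≡ 0ℚ
  order4 𝒪 2P≢𝒪 _ = contradiction refl 2P≢𝒪
  order4 P@(affine x y e) 2P≢𝒪 2P≡-2P with P ⊞ P in eq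
  ... | 𝒪 = contradiction refl 2P≢𝒪
  ... | affine X Y e′ = x , X , double-isDouble x y X Y e e′ eq ,
    trans (sym (recompute (_ ℚₚ.≟ _) e′)) (cong (λ t → t ℚ.* t) (x≡-x⇒x≡0 Y (cong ordinate 2P≡-2P)))

  -- Negation preserves the abscissa, so 2P = -P has the same one as P.
  order3 : ∀ P → P ≢ 𝒪 → P ⊞ P ≡ ⊟ P → ∃[ x ] IsDouble x x
  order3 𝒪 P≢𝒪 _ = contradiction refl P≢𝒪
  order3 (affine x y e) _ 2P≡-P = x , double-isDouble x y x (ℚ.- y) e _ 2P≡-P

  -- Transfer of elements of order 4 and 3 from an abstract torsion group

  module _ {G : RawGroup 0ℓ 0ℓ} (T : TorsionSubgroup≅ G) where
    open RawGroup G
    open TorsionSubgroup≅ T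
    open GroupMorphisms.IsGroupMonomorphism isMonomorphism

    to-≢𝒪 : ∀ g → ¬ g ≈ ε → to g ≢ 𝒪
    to-≢𝒪 g g≉ε to-g≡𝒪 = g≉ε (injective (trans to-g≡𝒪 (sym ε-homo)))

    torsion-order4 : ∀ g → ¬ g ∙ g ≈ ε → g ∙ g ≈ (g ∙ g) ⁻¹ →
                     ∃[ x ] ∃[ X ] IsDouble x X × cubic X ≡ 0ℚ
    torsion-order4 g 2g≉ε 2g≈-2g = order4 (to g)
      (subst (_≢ 𝒪) (∙-homo g g) (to-≢𝒪 (g ∙ g) 2g≉ε))
      (subst (λ Q → Q ≡ ⊟ Q) (∙-homo g g) (trans (⟦⟧-cong 2g≈-2g) (⁻¹-homo (g ∙ g))))

    torsion-order3 : ∀ g → ¬ g ≈ ε → g ∙ g ≈ g ⁻¹ → ∃[ x ] IsDouble x x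
    torsion-order3 g g≉ε 2g≈-g = order3 (to g) (to-≢𝒪 g g≉ε)
      (trans (sym (∙-homo g g)) (trans (⟦⟧-cong 2g≈-g) (⁻¹-homo g)))

root≐ : ∀ {X} a → X ℚ.+ ι a ≡ 0ℚ → X ≐ + 0 ℤ.- a
root≐ {X} a X+a≡0 = ≐-trans
  (trans (solve 2 (λ X a → X := (X :+ a) :- a) refl X (ι a)) (cong (ℚ._- ι a) X+a≡0))
  (≐-- (≐-ι (+ 0)) (≐-ι a))
  where open ℚSolver.+-*-Solver

-- The curve E(-pk, qk)

module _ (p q k : ℕ) .{{_ : NonZero p}} .{{_ : NonZero q}} (p⊥q : Coprime p q) (sf : Squarefree k) where

  m n : ℤ
  m = - (+ (p * k))
  n = + (q * k)

  instance
    k≢0 : NonZero k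
    k≢0 = ℕ.≢-nonZero (squarefree⇒≢0 sf)

  order4⇒k≡1 : ∀ {x X} → IsDouble (ι m) (ι n) x X → Curve.cubic (ι m) (ι n) X ≡ 0ℚ → k ≡ 1
  order4⇒k≡1 {x} {X} dbl root with x*y≡0⇒x≡0⊎y≡0 (X ℚ.* (X ℚ.+ ι m)) (X ℚ.+ ι n) root
  -- X = -qk is negative, so not a square.
  ... | inj₂ X+n≡0 with w , ww≡X ← IsDouble.X-square dbl =
    contradiction
      (≐-trans ww≡X (subst (X ≐_) (ℤₚ.+-identityˡ (- n)) (root≐ n X+n≡0)))
      (square≢neg w (q * k) {{ℕₚ.m*n≢0 q k}})
  ... | inj₁ X[X+m]≡0 with x*y≡0⇒x≡0⊎y≡0 X (X ℚ.+ ι m) X[X+m]≡0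
  -- X = 0 would make the negative number X + m = -pk a square.
  ...   | inj₁ X≡0 with w , ww≡X+m ← IsDouble.X+m-square dbl =
    contradiction
      (≐-trans (trans ww≡X+m (trans (cong (ℚ._+ ι m) X≡0) (ℚₚ.+-identityˡ (ι m)))) (≐-ι m))
      (square≢neg w (p * k) {{ℕₚ.m*n≢0 p k}})
  -- Only X = pk remains, where X + n = (p + q)k.
  ...   | inj₂ X+m≡0 with IsDouble.X-square dbl | IsDouble.X+n-square dbl
  ...     | w , ww≡X | v , vv≡X+n = p⊥q (k∣p , ℕᵈ.∣m+n∣m⇒∣n k∣p+q k∣p)
    where
    X≐pk : X ≐ + (p * k)
    X≐pk = subst (X ≐_) (trans (ℤₚ.+-identityˡ (- m)) (ℤₚ.neg-involutive (+ (p * k)))) (root≐ m X+m≡0)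
    k∣p : k ∣ p
    k∣p = squarefree-∣-ℚ-cofactor p w sf (≐-trans ww≡X X≐pk)
    k∣p+q : k ∣ p ℕ.+ q
    k∣p+q = squarefree-∣-ℚ-cofactor (p ℕ.+ q) v sf (≐-trans vv≡X+n
      (subst (X ℚ.+ ι n ≐_) (cong +_ (sym (ℕₚ.*-distribʳ-+ k p q))) (≐-+ X≐pk (≐-ι n))))

  -- These are the conditions on x = (A/D)² with denominators cleared: the two square conditions are
  -- multiplied by D², the duplication formula by D⁸.
  order3-integral : ∀ A B C D → Coprime ∣ A ∣ D →
    B ℤ.* B ≡ A ℤ.* A ℤ.+ m ℤ.* + (D * D) →
    C ℤ.* C ≡ A ℤ.* A ℤ.+ n ℤ.* + (D * D) →
    (let X = A ℤ.* A; E = + (D * D); V = X ℤ.* X ℤ.- (m ℤ.* E) ℤ.* (n ℤ.* E) in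
     + 4 ℤ.* (X ℤ.* (X ℤ.+ m ℤ.* E) ℤ.* (X ℤ.+ n ℤ.* E)) ℤ.* X ≡ V ℤ.* V) →
    k ∣ 3
  order3-integral A B C D A⊥D BB≡ CC≡ dup =
    Coprimality.coprime-divisor k⊥A⁸ (subst (k ∣_) abs-eq (ℤˢ.∣⇒∣ᵤ {+ k} K∣A⁸3))
    where
    E M N A² A⁴ A⁸ : ℤ
    E = + (D * D)
    M = m ℤ.* E
    N = n ℤ.* E
    A² = A ℤ.* A
    A⁴ = A² ℤ.* A²
    A⁸ = A⁴ ℤ.* A⁴
    a² a⁴ a⁸ : ℕ
    a² = ∣ A ∣ * ∣ A ∣
    a⁴ = a² * a²
    a⁸ = a⁴ * a⁴
    abs-eq : ∣ A⁸ ℤ.* + 3 ∣ ≡ a⁸ * 3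
    abs-eq = trans (ℤₚ.abs-* A⁸ (+ 3)) (cong (_* 3)
      (sq A⁴ (sq A² (sq A refl))))
      where
      sq : ∀ Z {z} → ∣ Z ∣ ≡ z → ∣ Z ℤ.* Z ∣ ≡ z * z
      sq Z refl = ℤₚ.abs-* Z Z
    ∣M∣ : ∣ M ∣ ≡ p * (k * (D * D))
    ∣M∣ = trans (ℤₚ.abs-* m E) (trans (cong (_* (D * D)) (ℤₚ.∣-i∣≡∣i∣ (+ (p * k)))) (ℕₚ.*-assoc p k (D * D)))
    ∣N∣ : ∣ N ∣ ≡ q * (k * (D * D))
    ∣N∣ = trans (ℤₚ.abs-* n E) (ℕₚ.*-assoc q k (D * D))
    k∣M : k ∣ ∣ M ∣
    k∣M = subst (k ∣_) (sym ∣M∣) (ℕᵈ.∣n⇒∣m*n p (ℕᵈ.m∣m*n (D * D)))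
    k∣N : k ∣ ∣ N ∣
    k∣N = subst (k ∣_) (sym ∣N∣) (ℕᵈ.∣n⇒∣m*n q (ℕᵈ.m∣m*n (D * D)))
    A⊥k : Coprime ∣ A ∣ k
    -- Coprimality of p and q reduces d² ∣ pkD² and d² ∣ qkD² to d² ∣ kD². Since d divides A, it is
    -- coprime to D, so the factor D² drops out too.
    A⊥k {d} (d∣A , d∣k) = sf d (Coprimality.coprime-divisor dd⊥DD
      (subst (d * d ∣_) (ℕₚ.*-comm k (D * D)) (Coprimality.coprime-factors p⊥q
        (subst (d * d ∣_) ∣M∣ (squarefree-∣-difference A B M (squarefree-∣ sf d∣k) d∣A (ℕᵈ.∣-trans d∣k k∣M) BB≡) ,
         subst (d * d ∣_) ∣N∣ (squarefree-∣-difference A C N (squarefree-∣ sf d∣k) d∣A (ℕᵈ.∣-trans d∣k k∣N) CC≡)))))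
      where
      d⊥D : Coprime d D
      d⊥D (i∣d , i∣D) = A⊥D (ℕᵈ.∣-trans i∣d d∣A , i∣D)
      D⊥dd : Coprime D (d * d)
      D⊥dd = Coprimality.sym (coprime-* d⊥D d⊥D)
      dd⊥DD : Coprime (d * d) (D * D)
      dd⊥DD = Coprimality.sym (coprime-* D⊥dd D⊥dd)
    k⊥A⁸ : Coprime k a⁸
    k⊥A⁸ = Coprimality.sym (sq (sq (sq A⊥k)))
      where
      sq : ∀ {a} → Coprime a k → Coprime (a * a) k
      sq c = coprime-* c c
    K∣A⁸3 : (+ k) ℤˢ.∣ (A⁸ ℤ.* + 3)
    K∣A⁸3 = subst (+ k ℤˢ.∣_) (sym A⁸3≡) (ℤˢ.∣m∣n⇒∣m+n
      (ℤˢ.∣n⇒∣m*n U (ℤˢ.∣ᵤ⇒∣ k∣M)) (ℤˢ.∣n⇒∣m*n W (ℤˢ.∣ᵤ⇒∣ k∣N)))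
      where
      open ℤSolver.+-*-Solver
      open ≡-Reasoning
      X = A²
      V = X ℤ.* X ℤ.- M ℤ.* N
      -- L - V² = 3X⁴ + 4X³(M + N) + 6X²MN - M²N² is the 3-division polynomial of the scaled curve.
      -- Every term except 3X⁴ = 3A⁸ contains M or N; `U` and `W` collect the cofactors.
      U = N ℤ.* (M ℤ.* N ℤ.- + 6 ℤ.* (X ℤ.* X)) ℤ.- + 4 ℤ.* (X ℤ.* X ℤ.* X)
      W = - (+ 4 ℤ.* (X ℤ.* X ℤ.* X))
      L = + 4 ℤ.* (X ℤ.* (X ℤ.+ M) ℤ.* (X ℤ.+ N)) ℤ.* X
      A⁸3≡ : A⁸ ℤ.* + 3 ≡ U ℤ.* M ℤ.+ W ℤ.* N
      A⁸3≡ = begin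
        A⁸ ℤ.* + 3
          ≡⟨ solve 3 (λ X M N →
               let V = X :* X :- M :* N
                   U = N :* (M :* N :- con (+ 6) :* (X :* X)) :- con (+ 4) :* (X :* X :* X)
                   W = :- (con (+ 4) :* (X :* X :* X))
                   L = con (+ 4) :* (X :* (X :+ M) :* (X :+ N)) :* X
               in (X :* X) :* (X :* X) :* con (+ 3) := (U :* M :+ W :* N) :+ (L :- V :* V)) refl X M N ⟩
        (U ℤ.* M ℤ.+ W ℤ.* N) ℤ.+ (L ℤ.- V ℤ.* V)
          ≡⟨ cong (λ t → (U ℤ.* M ℤ.+ W ℤ.* N) ℤ.+ t) (ℤₚ.i≡j⇒i-j≡0 dup) ⟩
        (U ℤ.* M ℤ.+ W ℤ.* N) ℤ.+ + 0
          ≡⟨ ℤₚ.+-identityʳ _ ⟩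
        U ℤ.* M ℤ.+ W ℤ.* N ∎

  order3⇒k∣3 : ∀ {x} → IsDouble (ι m) (ι n) x x → k ∣ 3
  order3⇒k∣3 {x} dbl with IsDouble.X-square dbl | IsDouble.X+m-square dbl | IsDouble.X+n-square dbl
  ... | a , aa≡x | b , bb≡x+m | c , cc≡x+n =
    order3-integral A (proj₁ B²) (proj₁ C²) D (numerator⊥denominator a) (proj₂ B²) (proj₂ C²)
      (≐-unique
        (≐-* (≐-* (≐-ι (+ 4)) (≐-* (≐-* xe≐X (≐-+ xe≐X me≐)) (≐-+ xe≐X ne≐))) xe≐X)
        (≐-trans scaled-duplication (≐-* v≐ v≐)))
    where
    open ≡-Reasoning
    open ℚSolver.+-*-Solver
    A = ↥ a
    D = ↧ₙ a
    E = + (D * D)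
    e = ι E
    v = x ℚ.* e ℚ.* (x ℚ.* e) ℚ.- ι m ℚ.* e ℚ.* (ι n ℚ.* e)
    scaled-duplication :
      4ℚ ℚ.* (x ℚ.* e ℚ.* (x ℚ.* e ℚ.+ ι m ℚ.* e) ℚ.* (x ℚ.* e ℚ.+ ι n ℚ.* e)) ℚ.* (x ℚ.* e) ≡ v ℚ.* v
    scaled-duplication = begin
      4ℚ ℚ.* (x ℚ.* e ℚ.* (x ℚ.* e ℚ.+ ι m ℚ.* e) ℚ.* (x ℚ.* e ℚ.+ ι n ℚ.* e)) ℚ.* (x ℚ.* e)
        ≡⟨ solve 4 (λ x e m n →
             con 4ℚ :* (x :* e :* (x :* e :+ m :* e) :* (x :* e :+ n :* e)) :* (x :* e)
             := (e :* e) :* (e :* e) :* (con 4ℚ :* (x :* (x :+ m) :* (x :+ n)) :* x))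
             refl x e (ι m) (ι n) ⟩
      (e ℚ.* e) ℚ.* (e ℚ.* e) ℚ.* (4ℚ ℚ.* (x ℚ.* (x ℚ.+ ι m) ℚ.* (x ℚ.+ ι n)) ℚ.* x)
        ≡⟨ cong ((e ℚ.* e) ℚ.* (e ℚ.* e) ℚ.*_) (IsDouble.duplication dbl) ⟩
      (e ℚ.* e) ℚ.* (e ℚ.* e) ℚ.* ((x ℚ.* x ℚ.- ι m ℚ.* ι n) ℚ.* (x ℚ.* x ℚ.- ι m ℚ.* ι n))
        ≡⟨ solve 4 (λ x e m n →
             let u = x :* x :- m :* n
                 v = x :* e :* (x :* e) :- m :* e :* (n :* e)
             in (e :* e) :* (e :* e) :* (u :* u) := v :* v) refl x e (ι m) (ι n) ⟩
      v ℚ.* v ∎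
    e≡ : e ≡ ι (↧ a) ℚ.* ι (↧ a)
    e≡ = trans (cong ι (ℤₚ.pos-* D D)) (sym (≐-elim (≐-* (≐-ι (↧ a)) (≐-ι (↧ a)))))
    w²e : ∀ w → w ℚ.* w ℚ.* e ≡ (w ℚ.* ι (↧ a)) ℚ.* (w ℚ.* ι (↧ a))
    w²e w = trans (cong (w ℚ.* w ℚ.*_) e≡)
      (solve 2 (λ w d → w :* w :* (d :* d) := (w :* d) :* (w :* d)) refl w (ι (↧ a)))
    xe≐X : x ℚ.* e ≐ A ℤ.* A
    xe≐X = ≐-trans (trans (cong (ℚ._* e) (sym aa≡x)) (w²e a)) (≐-* (w*↧w≐↥w a) (w*↧w≐↥w a))
    me≐ : ι m ℚ.* e ≐ m ℤ.* E
    me≐ = ≐-* (≐-ι m) (≐-ι E)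
    ne≐ : ι n ℚ.* e ≐ n ℤ.* E
    ne≐ = ≐-* (≐-ι n) (≐-ι E)
    v≐ = ≐-- (≐-* xe≐X xe≐X) (≐-* me≐ ne≐)
    -- The rational number wD has the integral square D²(x + μ) = A² + μD², so that integer is the
    -- square of an integer.
    clear-denominator : ∀ w μ → w ℚ.* w ≡ x ℚ.+ ι μ → ∃[ B ] B ℤ.* B ≡ A ℤ.* A ℤ.+ μ ℤ.* E
    clear-denominator w μ ww≡ = square-≐⇒square (w ℚ.* ι (↧ a)) (≐-trans
      (trans (sym (w²e w)) (trans (cong (ℚ._* e) ww≡) (ℚₚ.*-distribʳ-+ e x (ι μ))))
      (≐-+ xe≐X (≐-* (≐-ι μ) (≐-ι E))))
    B² = clear-denominator b m bb≡x+m
    C² = clear-denominator c n cc≡x+n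

theorem3p3 : (p q k : ℕ) → .{{_ : NonZero p}} → .{{_ : NonZero q}} →
    Coprime p q → Squarefree k →
    (m n : ℤ) → m ≡ - (+ (p * k)) → n ≡ + (q * k) →
    ((torsion[E⟨ m , n ⟩]≅ ℤ/ 2 ⊕ ℤ/ 4) ⊎ (torsion[E⟨ m , n ⟩]≅ ℤ/ 2 ⊕ ℤ/ 8) → k ≡ 1)
    × (torsion[E⟨ m , n ⟩]≅ ℤ/ 2 ⊕ ℤ/ 6 → k ≡ 1 ⊎ k ≡ 3)
theorem3p3 p q k p⊥q sf m n refl refl = part-i , part-ii
  where
  part-i : (torsion[E⟨ m , n ⟩]≅ ℤ/ 2 ⊕ ℤ/ 4) ⊎ (torsion[E⟨ m , n ⟩]≅ ℤ/ 2 ⊕ ℤ/ 8) → k ≡ 1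
  -- (0, 1) has order 4: 4 does not divide 2, while 2 - (-2) = 4.
  part-i (inj₁ T) with _ , _ , dbl , root ← torsion-order4 (ι m) (ι n) T (+ 0 , + 1)
    (λ z → from-no (4 ℕᵈ.∣? 2) (proj₂ z)) (divides-refl 0 , divides-refl 1) =
    order4⇒k≡1 p q k p⊥q sf dbl root
  -- In ℤ/8 the element of order 4 is 2.
  part-i (inj₂ T) with _ , _ , dbl , root ← torsion-order4 (ι m) (ι n) T (+ 0 , + 2)
    (λ z → from-no (8 ℕᵈ.∣? 4) (proj₂ z)) (divides-refl 0 , divides-refl 1) =
    order4⇒k≡1 p q k p⊥q sf dbl root
  part-ii : torsion[E⟨ m , n ⟩]≅ ℤ/ 2 ⊕ ℤ/ 6 → k ≡ 1 ⊎ k ≡ 3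
  -- (0, 2) has order 3: 6 does not divide 2, while 4 - (-2) = 6.
  part-ii T with _ , dbl ← torsion-order3 (ι m) (ι n) T (+ 0 , + 2)
    (λ z → from-no (6 ℕᵈ.∣? 2) (proj₂ z)) (divides-refl 0 , divides-refl 1) =
    ∣3⇒≡1⊎≡3 (order3⇒k∣3 p q k p⊥q sf dbl)
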